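{- Every $3$-edge-colorable graph is $(7,2)$-edge-choosable.
   Context: A graph $G$ is $(r,s)$-edge-choosable if for every assignment $L$ of lists of size $r$ to the edges of $G$, one can choose for each edge $e$ a set of $s$ colors from $L(e)$ so that incident edges (edges sharing an endpoint) receive disjoint sets. A graph is $3$-edge-colorable if its edges can be colored with $3$ colors so that incident edges get different colors. -}

module Defs where

open import Data.Nat using (ℕ)
open import Data.Fin using (Fin)
open import Data.Product using (Σ; _×_; _,_; proj₁; proj₂; ∃-syntax)
open import Data.Sum using (_⊎_)
open import Data.List using (List; length)
open import Data.List.Relation.Unary.All using (All)
open import Data.List.Relation.Unary.Unique.Propositional using (Unique)
open import Data.List.Membership.Propositional using (_∈_; _∉_)
open import Relation.Binary.PropositionalEquality using (_≡_; _≢_)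

record Graph : Set where
  field
    n     : ℕ
    m     : ℕ
    ends  : Fin m → Fin n × Fin n
    loopless : ∀ e → proj₁ (ends e) ≢ proj₂ (ends e)
    simple : ∀ e f →
      (  (proj₁ (ends e) ≡ proj₁ (ends f) × proj₂ (ends e) ≡ proj₂ (ends f))
       ⊎ (proj₁ (ends e) ≡ proj₂ (ends f) × proj₂ (ends e) ≡ proj₁ (ends f)))
      → e ≡ f

open Graph public

_isEndOf_ : {G : Graph} → Fin (n G) → Fin (m G) → Set
_isEndOf_ {G} v e = (v ≡ proj₁ (ends G e)) ⊎ (v ≡ proj₂ (ends G e))

Incident : (G : Graph) → Fin (m G) → Fin (m G) → Set
Incident G e f = e ≢ f × (∃[ v ] (_isEndOf_ {G} v e × _isEndOf_ {G} v f))

ThreeEdgeColorable : Graph → Set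
ThreeEdgeColorable G =
  Σ (Fin (m G) → Fin 3) λ col → ∀ e f → Incident G e f → col e ≢ col f

IsList : ℕ → List ℕ → Set
IsList r l = Unique l × length l ≡ r

EdgeChoosable : ℕ → ℕ → Graph → Set
EdgeChoosable r s G =
  (L : Fin (m G) → List ℕ) → (∀ e → IsList r (L e)) →
  Σ (Fin (m G) → List ℕ) λ C →
      (∀ e → IsList s (C e) × All (_∈ L e) (C e))
    × (∀ e f → Incident G e f → ∀ c → c ∈ C e → c ∉ C f)

{-# OPTIONS --safe #-}

-- Colour classes 0, 1, 2.  Say that p and q share around a list B if p = q or
-- one of them is missing from B: a list then loses at most one colour to p and q.
-- If each vertex v and each link f of a multigraph of maximum degree 2 carries a
-- list of k ≥ 1 colours, then one colour c(v) can be chosen at each vertex such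
-- that the ends of every link f share around the list of f.
--
-- First put the lists of the class 0 edges on their ends, with the edges of
-- classes 1 and 2 as links.  A class 0 edge uv receives two colours including
-- c(u) and c(v); then every other edge loses at most 3 of its 7 colours.
-- Next put the lists of the class 1 edges on their ends, with the class 2 edges as
-- links, and the class 1 edges as links forcing equality.  This gives every
-- class 1 edge a colour and costs every class 2 edge at most one colour.  Doing
-- so twice leaves 4 - 2 = 2 colours on the class 2 edges.

module Submission where

open import Defs
open import Algebra.Properties.CommutativeSemigroup using (x∙yz≈y∙xz)
open import Data.Bool using (if_then_else_)
open import Data.Fin using (Fin)
open import Data.Fin.Patterns using (0F; 1F; 2F)
import Data.Fin.Properties as Fin
open import Data.List using (List; []; _∷_; [_]; _++_; length; filter; take; upTo; allFin)
open import Data.List.Membership.Propositional using (_∈_; _∉_; find)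
open import Data.List.Membership.Propositional.Properties using (∈-filter⁺; ∈-filter⁻; ∈-++⁺ˡ; ∈-++⁺ʳ; ∈-allFin)
open import Data.List.Properties using (length-++; length-take; length-upTo)
open import Data.List.Relation.Binary.Subset.Propositional using (_⊆_)
open import Data.List.Relation.Binary.Subset.Propositional.Properties using (xs⊆x∷xs; ∷⁺ʳ)
open import Data.List.Relation.Unary.All using (All; []; _∷_; all?; lookup; tabulate)
open import Data.List.Relation.Unary.All.Properties using (¬All⇒Any¬; ¬Any⇒All¬; all-filter; ++⁻)
open import Data.List.Relation.Unary.AllPairs using ([]; _∷_)
open import Data.List.Relation.Unary.Any using (here; there)
open import Data.List.Relation.Unary.Unique.Propositional using (Unique)
import Data.List.Relation.Unary.Unique.Propositional.Properties as Unique
open import Data.Nat using (ℕ; suc; _+_; _≤_; z≤n; s≤s)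
import Data.Nat.Properties as ℕ
open import Data.Product using (Σ; ∃; _×_; _,_; proj₁; proj₂)
open import Data.Sum using (_⊎_; inj₁; inj₂)
open import Data.Vec.Functional using (updateAt)
open import Data.Vec.Functional.Properties using (updateAt-updates; updateAt-minimal)
open import Function using (_∘_; flip; id)
open import Relation.Binary.PropositionalEquality using (_≡_; _≢_; refl; sym; trans; cong; cong₂; subst; subst₂)
open import Relation.Nullary using (¬_; Dec; yes; no; does; contradiction)
open import Relation.Nullary.Decidable using (_×-dec_; _⊎-dec_; ¬?)
open import Data.List.Membership.DecPropositional ℕ._≟_ using (_∈?_)

-- Lists as finite sets

module _ {X : Set} where

  ∈-remove : {x : X} {xs : List X} → x ∈ xs →
             ∃ λ ys → length xs ≡ suc (length ys) × xs ⊆ x ∷ ys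
  ∈-remove {xs = _ ∷ ys} (here refl) = ys , refl , id
  ∈-remove {x} {y ∷ xs} (there x∈xs) with ∈-remove x∈xs
  ... | ys , eq , sub = y ∷ ys , cong suc eq , λ where
    (here refl)  → there (here refl)
    (there z∈xs) → ∷⁺ʳ x (xs⊆x∷xs ys y) (sub z∈xs)

  Unique-⊆⇒length≤ : {xs ys : List X} → Unique xs → xs ⊆ ys → length xs ≤ length ys
  Unique-⊆⇒length≤ {[]} _ _ = z≤n
  Unique-⊆⇒length≤ {x ∷ xs} {ys} (x≢xs ∷ u) sub with ∈-remove (sub (here refl))
  ... | zs , eq , ys⊆ = subst (suc (length xs) ≤_) (sym eq)
          (s≤s (Unique-⊆⇒length≤ u λ y∈xs → drop-head y∈xs (ys⊆ (sub (there y∈xs)))))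
    where
    drop-head : ∀ {y} → y ∈ xs → y ∈ x ∷ zs → y ∈ zs
    drop-head y∈xs (here refl) = contradiction refl (lookup x≢xs y∈xs)
    drop-head _    (there p)   = p

-- An element of `ys` outside `xs`, put in front of `xs`, would give `k + 1` distinct elements of a
-- list of length `k`.
IsList-⊆⇒⊇ : ∀ {k xs ys} → IsList k xs → IsList k ys → xs ⊆ ys → ys ⊆ xs
IsList-⊆⇒⊇ {k} {xs} {ys} (u , lx) (_ , ly) sub {y} y∈ys with y ∈? xs
... | yes y∈xs = y∈xs
... | no  y∉xs = contradiction
        (subst₂ _≤_ (cong suc lx) ly
          (Unique-⊆⇒length≤ (¬Any⇒All¬ xs y∉xs ∷ u) λ { (here refl) → y∈ys ; (there p) → sub p }))
        ℕ.1+n≰n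

⊆-or-outside : ∀ xs ys → xs ⊆ ys ⊎ ∃ λ x → x ∈ xs × x ∉ ys
⊆-or-outside xs ys with all? (_∈? ys) xs
... | yes p = inj₁ (lookup p)
... | no ¬p = inj₂ (find (¬All⇒Any¬ (_∈? ys) xs ¬p))

IsList-outside : ∀ {k xs ys y} → IsList k xs → IsList k ys → y ∈ ys → y ∉ xs →
                 ∃ λ x → x ∈ xs × x ∉ ys
IsList-outside {xs = xs} {ys} lx ly y∈ys y∉xs with ⊆-or-outside xs ys
... | inj₁ sub = contradiction (IsList-⊆⇒⊇ lx ly sub y∈ys) y∉xs
... | inj₂ out = out

IsList-inhabited : ∀ {k xs} → IsList (suc k) xs → ∃ λ x → x ∈ xs
IsList-inhabited {xs = x ∷ _} _ = x , here refl

take-⊆ : ∀ k (xs : List ℕ) → take k xs ⊆ xs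
take-⊆ (suc k) (x ∷ xs) (here p)  = here p
take-⊆ (suc k) (x ∷ xs) (there p) = there (take-⊆ k xs p)

-- The colours of `L` outside `D` may number more than `k`, so `take` cuts them down to exactly `k`.
-- `D` may contain repetitions: only the distinct elements of `L` are counted, inside `F ++ D`.
avoid : ∀ {k L} D → IsList (k + length D) L →
        ∃ λ L′ → IsList k L′ × L′ ⊆ L × (∀ {c} → c ∈ L′ → c ∉ D)
avoid {k} {L} D (u , len) =
  take k F , (Unique.take⁺ k (Unique.filter⁺ outside? u) , trans (length-take k F) (ℕ.m≤n⇒m⊓n≡m k≤F)) ,
  proj₁ ∘ ∈-filter⁻ outside? ∘ take-⊆ k F , proj₂ ∘ ∈-filter⁻ outside? {xs = L} ∘ take-⊆ k F
  where
  outside? = λ c → ¬? (c ∈? D)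
  F = filter outside? L
  L⊆F++D : L ⊆ F ++ D
  L⊆F++D {c} c∈L with c ∈? D
  ... | yes c∈D = ∈-++⁺ʳ F c∈D
  ... | no  c∉D = ∈-++⁺ˡ (∈-filter⁺ outside? c∈L c∉D)
  k≤F : k ≤ length F
  k≤F = ℕ.+-cancelʳ-≤ (length D) k (length F)
          (subst₂ _≤_ len (length-++ F) (Unique-⊆⇒length≤ u L⊆F++D))

-- Removing and choosing small sets of colours

Share : List ℕ → ℕ → ℕ → Set
Share B p q = p ≡ q ⊎ (p ∉ B ⊎ q ∉ B)

-- `P` and `Q` cost `L` only `i + j + 1` colours: if `p ≡ q` the two count once, and if one of them
-- is missing from `L` it is avoided already.
avoid-sharing : ∀ {k L P Q p q} i j → length P ≡ suc i → length Q ≡ suc j → p ∈ P → q ∈ Q →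
                Share L p q → IsList (k + suc (i + j)) L →
                ∃ λ L′ → IsList k L′ × L′ ⊆ L × (∀ {c} → c ∈ L′ → c ∉ P × c ∉ Q)
avoid-sharing {k} {L} {P} {Q} {p} {q} i j lP lQ p∈P q∈Q share isL
  with ∈-remove p∈P | ∈-remove q∈Q
... | ps , eP , P⊆ | qs , eQ , Q⊆ = go share
  where
  len : length (ps ++ qs) ≡ i + j
  len = trans (length-++ ps)
          (cong₂ _+_ (ℕ.suc-injective (trans (sym eP) lP)) (ℕ.suc-injective (trans (sym eQ) lQ)))

  via : ∀ d → (∀ {c} → c ∈ L → c ≢ d → c ≢ p × c ≢ q) →
        ∃ λ L′ → IsList k L′ × L′ ⊆ L × (∀ {c} → c ∈ L′ → c ∉ P × c ∉ Q)
  via d enough with avoid (d ∷ ps ++ qs) (subst (λ l → IsList (k + suc l) L) (sym len) isL)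
  ... | L′ , isL′ , L′⊆L , off = L′ , isL′ , L′⊆L , λ {c} c∈L′ →
    let c≢p , c≢q = enough (L′⊆L c∈L′) (off c∈L′ ∘ here)
    in (λ c∈P → strip c≢p (λ r → off c∈L′ (there (∈-++⁺ˡ r))) (P⊆ c∈P)) ,
       (λ c∈Q → strip c≢q (λ r → off c∈L′ (there (∈-++⁺ʳ ps r))) (Q⊆ c∈Q))
    where
    strip : ∀ {c x : ℕ} {xs} → c ≢ x → c ∉ xs → c ∉ x ∷ xs
    strip c≢x _ (here c≡x) = c≢x c≡x
    strip _ c∉ (there r)   = c∉ r

  go : Share L p q → _
  go (inj₁ refl)       = via p λ _ c≢p → c≢p , c≢p
  go (inj₂ (inj₁ p∉L)) = via q λ c∈L c≢q → (λ { refl → p∉L c∈L }) , c≢q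
  go (inj₂ (inj₂ q∉L)) = via p λ c∈L c≢p → c≢p , λ { refl → q∉L c∈L }

pair-containing : ∀ {k L a b} → IsList (2 + k) L → a ∈ L → b ∈ L →
                  ∃ λ C → (IsList 2 C × All (_∈ L) C) × a ∈ C × b ∈ C
pair-containing {k} {L} {a} {b} isL a∈L b∈L with a ℕ.≟ b
... | no  a≢b = a ∷ b ∷ [] , ((((a≢b ∷ []) ∷ [] ∷ []) , refl) , a∈L ∷ b∈L ∷ []) ,
                here refl , there (here refl)
... | yes refl with avoid {suc k} [ a ] (subst (λ l → IsList l L) (ℕ.+-comm 1 (suc k)) isL)
... | L′ , isL′ , L′⊆L , off with IsList-inhabited isL′
... | x , x∈L′ = a ∷ x ∷ [] ,
                 (((((λ a≡x → off x∈L′ (here (sym a≡x))) ∷ []) ∷ [] ∷ []) , refl) , a∈L ∷ L′⊆L x∈L′ ∷ []) ,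
                 here refl , here refl

-- Relations that can be solved along paths and around cycles

-- The point of this notion is that it is closed under composition while every
-- such relation from a nonempty list to itself has a fixed point.
data Anchored (A B : List ℕ) (R : ℕ → ℕ → Set) : Set where
  diagonal : A ⊆ B → B ⊆ A → (∀ {a} → a ∈ A → R a a) → Anchored A B R
  leftHub  : ∀ {a} → a ∈ A → (∀ {b} → b ∈ B → R a b) → Anchored A B R
  rightHub : ∀ {b} → b ∈ B → (∀ {a} → a ∈ A → R a b) → Anchored A B R

-- Extension in both directions carries hubs through compositions, and lets the end of a path be
-- coloured after the rest.
record Good (A B : List ℕ) (R : ℕ → ℕ → Set) : Set where
  field
    extendʳ  : ∀ {a} → a ∈ A → ∃ λ b → b ∈ B × R a b
    extendˡ  : ∀ {b} → b ∈ B → ∃ λ a → a ∈ A × R a b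
    anchored : Anchored A B R

open Good

Good-flip : ∀ {A B R} → Good A B R → Good B A (flip R)
Good-flip g .extendʳ = g .extendˡ
Good-flip g .extendˡ = g .extendʳ
Good-flip g .anchored with g .anchored
... | diagonal s t d = diagonal t s (d ∘ t)
... | leftHub i h    = rightHub i h
... | rightHub i h   = leftHub i h

Composite : List ℕ → (R S : ℕ → ℕ → Set) → ℕ → ℕ → Set
Composite B R S a c = ∃ λ b → b ∈ B × R a b × S b c

-- A hub of one factor is carried through the other by extension, or by the equality of lists in
-- `diagonal`. Two diagonals compose to a diagonal.
Good-compose : ∀ {A B C R S} → Good A B R → Good B C S → Good A C (Composite B R S)
Good-compose g h .extendʳ a∈A =
  let b , b∈B , r = g .extendʳ a∈A ; c , c∈C , s = h .extendʳ b∈B in c , c∈C , b , b∈B , r , s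
Good-compose g h .extendˡ c∈C =
  let b , b∈B , s = h .extendˡ c∈C ; a , a∈A , r = g .extendˡ b∈B in a , a∈A , b , b∈B , r , s
Good-compose g h .anchored with g .anchored | h .anchored
... | leftHub a∈A r | _ =
  leftHub a∈A λ c∈C → let b , b∈B , s = h .extendˡ c∈C in b , b∈B , r b∈B , s
... | rightHub b∈B r | _ =
  let c , c∈C , s = h .extendʳ b∈B in rightHub c∈C λ a∈A → _ , b∈B , r a∈A , s
... | diagonal _ B⊆A r | leftHub b∈B s =
  leftHub (B⊆A b∈B) λ c∈C → _ , b∈B , r (B⊆A b∈B) , s c∈C
... | diagonal _ _ _ | rightHub c∈C s =
  rightHub c∈C λ a∈A → let b , b∈B , r = g .extendʳ a∈A in b , b∈B , r , s b∈B
... | diagonal A⊆B B⊆A r | diagonal B⊆C C⊆B s =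
  diagonal (B⊆C ∘ A⊆B) (B⊆A ∘ C⊆B) λ a∈A → _ , A⊆B a∈A , r a∈A , s (A⊆B a∈A)

-- With equal end lists a hub belongs to both sides, so it is related to itself.
Good-fixpoint : ∀ {A R} → ∃ (_∈ A) → Good A A R → ∃ λ a → a ∈ A × R a a
Good-fixpoint (a , a∈A) g with g .anchored
... | diagonal _ _ r = a , a∈A , r a∈A
... | leftHub i r    = _ , i , r i
... | rightHub i r   = _ , i , r i

Good-≡ : ∀ {A} → Good A A _≡_
Good-≡ .extendʳ a∈A = _ , a∈A , refl
Good-≡ .extendˡ a∈A = _ , a∈A , refl
Good-≡ .anchored    = diagonal id id λ _ → refl

-- If `a` lies in `B` but not in `A′`, equal sizes force some element of `A′` outside `B`, and it
-- shares with everything. Otherwise `a` itself, or any element of `A′`, will do.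
Share-extendʳ : ∀ {k A A′ B a} → IsList (suc k) A′ → IsList (suc k) B → a ∈ A →
                ∃ λ b → b ∈ A′ × Share B a b
Share-extendʳ {A′ = A′} {B} {a} lA′ lB a∈A with a ∈? A′ | a ∈? B
... | yes a∈A′ | _      = a , a∈A′ , inj₁ refl
... | no _    | no a∉B  = let b , b∈A′ = IsList-inhabited lA′ in b , b∈A′ , inj₂ (inj₁ a∉B)
... | no a∉A′ | yes a∈B =
  let b , b∈A′ , b∉B = IsList-outside lA′ lB a∈B a∉A′ in b , b∈A′ , inj₂ (inj₂ b∉B)

Share-sym : ∀ {B a b} → Share B a b → Share B b a
Share-sym (inj₁ eq)       = inj₁ (sym eq)
Share-sym (inj₂ (inj₁ p)) = inj₂ (inj₂ p)
Share-sym (inj₂ (inj₂ p)) = inj₂ (inj₁ p)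

-- A colour of either list missing from `B` is a hub. If there is none, equal sizes force `A`, `B`
-- and `A′` to be the same set, and equality gives the diagonal.
Good-Share : ∀ {k A A′ B} → IsList (suc k) A → IsList (suc k) A′ → IsList (suc k) B →
             Good A A′ (Share B)
Good-Share lA lA′ lB .extendʳ a∈A = Share-extendʳ lA′ lB a∈A
Good-Share lA lA′ lB .extendˡ b∈A′ =
  let a , a∈A , s = Share-extendʳ lA lB b∈A′ in a , a∈A , Share-sym s
Good-Share {A = A} {A′} {B} lA lA′ lB .anchored with ⊆-or-outside A B | ⊆-or-outside A′ B
... | inj₂ (a , a∈A , a∉B) | _ = leftHub a∈A λ _ → inj₂ (inj₁ a∉B)
... | inj₁ _ | inj₂ (b , b∈A′ , b∉B) = rightHub b∈A′ λ _ → inj₂ (inj₂ b∉B)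
... | inj₁ A⊆B | inj₁ A′⊆B =
  diagonal (IsList-⊆⇒⊇ lA′ lB A′⊆B ∘ A⊆B) (IsList-⊆⇒⊇ lA lB A⊆B ∘ A′⊆B) λ _ → inj₁ refl

-- Multigraphs of maximum degree 2

module _ {N : ℕ} where

  δ : Fin N → Fin N → ℕ
  δ x y = if does (x Fin.≟ y) then 1 else 0

  δ-refl : ∀ x → δ x x ≡ 1
  δ-refl x with x Fin.≟ x
  ... | yes _   = refl
  ... | no  x≢x = contradiction refl x≢x

  δ≡0⇒≢ : ∀ {x y} → δ x y ≡ 0 → x ≢ y
  δ≡0⇒≢ {x} δ≡0 refl with trans (sym δ≡0) (δ-refl x)
  ... | ()

module Network {N : ℕ} (A : Fin N → List ℕ) (inhabited : ∀ v → ∃ (_∈ A v)) where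

  record Link : Set₁ where
    constructor link
    field
      source target : Fin N
      rel           : ℕ → ℕ → Set
      good          : Good (A source) (A target) rel

  open Link

  Solves : (Fin N → ℕ) → Link → Set
  Solves c l = rel l (c (source l)) (c (target l))

  -- A loop counts twice, so under maximum degree 2 no other link meets its vertex.
  degree : Fin N → List Link → ℕ
  degree x []       = 0
  degree x (l ∷ ls) = δ x (source l) + δ x (target l) + degree x ls

  degree-++ : ∀ x ls ls′ → degree x (ls ++ ls′) ≡ degree x ls + degree x ls′
  degree-++ x []       ls′ = refl
  degree-++ x (l ∷ ls) ls′ =
    trans (cong (δ x (source l) + δ x (target l) +_) (degree-++ x ls ls′))
          (sym (ℕ.+-assoc (δ x (source l) + δ x (target l)) _ _))

  Solves-update : ∀ {c v b} ls → degree v ls ≡ 0 → All (Solves c) ls →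
                  All (Solves (updateAt c v λ _ → b)) ls
  Solves-update [] _ [] = []
  Solves-update {c} {v} (l ∷ ls) deg (s ∷ ss) =
    subst₂ (rel l) (sym (updateAt-minimal _ v c (δ≡0⇒≢ δs ∘ sym)))
                   (sym (updateAt-minimal _ v c (δ≡0⇒≢ δt ∘ sym))) s
    ∷ Solves-update ls (ℕ.m+n≡0⇒n≡0 (δ v (source l) + δ v (target l)) deg) ss
    where
    δ+δ = ℕ.m+n≡0⇒m≡0 (δ v (source l) + δ v (target l)) deg
    δs  = ℕ.m+n≡0⇒m≡0 (δ v (source l)) δ+δ
    δt  = ℕ.m+n≡0⇒n≡0 (δ v (source l)) δ+δ

  ∈-update : ∀ {c v b} → b ∈ A v → (∀ x → c x ∈ A x) → ∀ x → updateAt c v (λ _ → b) x ∈ A x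
  ∈-update {c} {v} {b} b∈ c∈ x with x Fin.≟ v
  ... | yes refl = subst (_∈ A v) (sym (updateAt-updates v c)) b∈
  ... | no  x≢v  = subst (_∈ A x) (sym (updateAt-minimal x v c x≢v)) (c∈ x)

  -- A link at `x`, reversed if necessary so as to start there. `degrees` and `solves` stand in for
  -- the statement that `ls` is, up to order and reversal, this link followed by `rest`.
  record Extraction (x : Fin N) (ls : List Link) : Set₁ where
    field
      target′ : Fin N
      rel′    : ℕ → ℕ → Set
      good′   : Good (A x) (A target′) rel′
      rest    : List Link
      shorter : length ls ≡ suc (length rest)
      degrees : ∀ y → degree y ls ≡ δ y x + δ y target′ + degree y rest
      solves  : ∀ c → rel′ (c x) (c target′) → All (Solves c) rest → All (Solves c) ls

  open Extraction

  extract : ∀ x ls → degree x ls ≡ 0 ⊎ Extraction x ls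
  extract x [] = inj₁ refl
  extract x (link s t R g ∷ ls) with x Fin.≟ s | x Fin.≟ t | extract x ls
  ... | yes refl | _ | _ = inj₂ record
    { target′ = t ; rel′ = R ; good′ = g ; rest = ls ; shorter = refl
    ; degrees = λ _ → refl ; solves = λ _ → _∷_ }
  ... | no _ | yes refl | _ = inj₂ record
    { target′ = s ; rel′ = flip R ; good′ = Good-flip g ; rest = ls ; shorter = refl
    ; degrees = λ y → cong (_+ degree y ls) (ℕ.+-comm (δ y s) (δ y x)) ; solves = λ _ → _∷_ }
  ... | no _ | no _ | inj₁ deg = inj₁ deg
  ... | no _ | no _ | inj₂ e = inj₂ record
    { target′ = target′ e ; rel′ = rel′ e ; good′ = good′ e
    ; rest    = link s t R g ∷ rest e
    ; shorter = cong suc (shorter e)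
    ; degrees = λ y → trans (cong (δ y s + δ y t +_) (degrees e y))
                            (x∙yz≈y∙xz ℕ.+-commutativeSemigroup (δ y s + δ y t) (δ y x + δ y (target′ e)) (degree y (rest e)))
    ; solves  = λ { c r (q ∷ qs) → q ∷ solves e c r qs } }

  Solution : List Link → Set₁
  Solution ls = ∃ λ c → (∀ v → c v ∈ A v) × All (Solves c) ls

  -- Contract one link at a time: a vertex v of degree 2 is bypassed by the composite
  -- of its two links, a vertex of degree 1 is coloured last.
  solve′ : ∀ k ls → length ls ≤ k → (∀ x → degree x ls ≤ 2) → Solution ls
  solve′ _ [] _ _ = proj₁ ∘ inhabited , proj₂ ∘ inhabited , []
  solve′ (suc k) (link u v R g ∷ ls) (s≤s len) deg with u Fin.≟ v
  -- A loop, for instance a cycle contracted to one vertex: a fixed point of its relation colours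
  -- `u`.
  ... | yes refl = updateAt c u (λ _ → a) , ∈-update a∈ c∈ ,
        subst₂ R (sym (updateAt-updates u c)) (sym (updateAt-updates u c)) r ∷ Solves-update ls u-free cs
    where
    loop = Good-fixpoint (inhabited u) g
    a    = proj₁ loop
    a∈   = proj₁ (proj₂ loop)
    r    = proj₂ (proj₂ loop)
    sub  = solve′ k ls len λ x → ℕ.≤-trans (ℕ.m≤n+m _ _) (deg x)
    c    = proj₁ sub
    c∈   = proj₁ (proj₂ sub)
    cs   = proj₂ (proj₂ sub)
    u-free : degree u ls ≡ 0
    u-free with subst (λ d → d + d + degree u ls ≤ 2) (δ-refl u) (deg u)
    ... | s≤s (s≤s p) = ℕ.n≤0⇒n≡0 p
  ... | no u≢v with extract v ls
  ...   | inj₁ v-free = updateAt c v (λ _ → b) , ∈-update b∈ c∈ ,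
          subst₂ R (sym (updateAt-minimal u v c u≢v)) (sym (updateAt-updates v c)) r
            ∷ Solves-update ls v-free cs
    where
    sub = solve′ k ls len λ x → ℕ.≤-trans (ℕ.m≤n+m _ _) (deg x)
    c   = proj₁ sub
    c∈  = proj₁ (proj₂ sub)
    cs  = proj₂ (proj₂ sub)
    ext = g .extendʳ (c∈ u)
    b   = proj₁ ext
    b∈  = proj₁ (proj₂ ext)
    r   = proj₂ (proj₂ ext)
  -- If `w` is `u`, the composite is a loop, which closes a cycle. The new list is as long as `ls`,
  -- one link shorter than before.
  ...   | inj₂ e = bypass (solve′ k (link u w _ (Good-compose g (good′ e)) ∷ rest e) (subst (_≤ k) (shorter e) len) deg′)
    where
    w = target′ e

    deg′ : ∀ x → δ x u + δ x w + degree x (rest e) ≤ 2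
    deg′ x = begin
      δ x u + δ x w + degree x (rest e)
        ≡⟨ ℕ.+-assoc (δ x u) _ _ ⟩
      δ x u + (δ x w + degree x (rest e))
        ≤⟨ ℕ.+-mono-≤ (ℕ.m≤m+n (δ x u) (δ x v)) (ℕ.+-monoˡ-≤ (degree x (rest e)) (ℕ.m≤n+m (δ x w) (δ x v))) ⟩
      δ x u + δ x v + (δ x v + δ x w + degree x (rest e))
        ≡⟨ cong (δ x u + δ x v +_) (degrees e x) ⟨
      δ x u + δ x v + degree x ls
        ≤⟨ deg x ⟩
      2 ∎
      where open ℕ.≤-Reasoning

    -- The two links use up the degree of `v`, so the second is not a loop and `rest e` misses `v`.
    v-rest : δ v w + degree v (rest e) ≡ 0
    v-rest with ℕ.≤-trans (ℕ.+-monoˡ-≤ (degree v ls) (ℕ.m≤n+m (δ v v) (δ v u))) (deg v)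
    ... | p rewrite degrees e v | δ-refl v with p
    ... | s≤s (s≤s q) = ℕ.n≤0⇒n≡0 q

    v≢w : v ≢ w
    v≢w = δ≡0⇒≢ (ℕ.m+n≡0⇒m≡0 (δ v w) v-rest)

    bypass : Solution (link u w _ (Good-compose g (good′ e)) ∷ rest e) → Solution (link u v R g ∷ ls)
    bypass (c , c∈ , (b , b∈ , r , s) ∷ cs) =
      updateAt c v (λ _ → b) , ∈-update b∈ c∈ ,
      subst₂ R (sym (updateAt-minimal u v c u≢v)) (sym (updateAt-updates v c)) r
      ∷ solves e _ (subst₂ (rel′ e) (sym (updateAt-updates v c)) (sym (updateAt-minimal w v c (v≢w ∘ sym))) s)
          (Solves-update (rest e) (ℕ.m+n≡0⇒n≡0 (δ v w) v-rest) cs)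

  solve : ∀ ls → (∀ x → degree x ls ≤ 2) → Solution ls
  solve ls = solve′ (length ls) ls ℕ.≤-refl

-- Edge-coloured graphs

module Coloured (G : Graph) (col : Fin (m G) → Fin 3)
                (proper : ∀ e f → Incident G e f → col e ≢ col f) where

  src tgt : Fin (m G) → Fin (n G)
  src e = proj₁ (ends G e)
  tgt e = proj₂ (ends G e)

  _isEnd_ : Fin (n G) → Fin (m G) → Set
  v isEnd e = _isEndOf_ {G} v e

  colour-unique : ∀ {k v} e f → col e ≡ k → col f ≡ k → v isEnd e → v isEnd f → e ≡ f
  colour-unique e f refl q ve vf with e Fin.≟ f
  ... | yes e≡f = e≡f
  ... | no  e≢f = contradiction (sym q) (proper e f (e≢f , _ , ve , vf))

  -- At most one edge of class `k` meets `v`, so data attached to these edges can be moved to their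
  -- ends; `default` serves the vertices they miss.
  spread : ∀ {X : Set} k (Q : Fin (n G) → X → Set) (F : Fin (m G) → X) → (∀ v → ∃ (Q v)) →
           (∀ e v → col e ≡ k → v isEnd e → Q v (F e)) →
           ∀ v → ∃ λ x → Q v x × (∀ e → col e ≡ k → v isEnd e → x ≡ F e)
  spread k Q F default q v
    with Fin.any? (λ e → (col e Fin.≟ k) ×-dec ((v Fin.≟ src e) ⊎-dec (v Fin.≟ tgt e)))
  ... | yes (e , ce , ve) = F e , q e v ce ve , λ f cf vf → cong F (colour-unique e f ce cf ve vf)
  ... | no  none = proj₁ (default v) , proj₂ (default v) ,
                   λ e ce ve → contradiction (e , ce , ve) none

  module _ (A : Fin (n G) → List ℕ) (inhabited : ∀ v → ∃ (_∈ A v)) where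

    open Network A inhabited

    module _ {k} (R : Fin (m G) → ℕ → ℕ → Set)
             (good : ∀ f → col f ≡ k → Good (A (src f)) (A (tgt f)) (R f)) where

      links : ∀ fs → All (λ f → col f ≡ k) fs → List Link
      links []       []       = []
      links (f ∷ fs) (p ∷ ps) = link (src f) (tgt f) (R f) (good f p) ∷ links fs ps

      links-avoid : ∀ x fs ps → (∀ {f} → f ∈ fs → ¬ (x isEnd f)) → degree x (links fs ps) ≡ 0
      links-avoid x []       []       _   = refl
      links-avoid x (f ∷ fs) (p ∷ ps) off with x Fin.≟ src f | x Fin.≟ tgt f
      ... | yes q | _     = contradiction (inj₁ q) (off (here refl))
      ... | no _  | yes q = contradiction (inj₂ q) (off (here refl))
      ... | no _  | no _  = links-avoid x fs ps (off ∘ there)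

      links-degree : ∀ x fs ps → Unique fs → degree x (links fs ps) ≤ 1
      links-degree x []       []       _ = z≤n
      links-degree x (f ∷ fs) (p ∷ ps) (f≢ ∷ u) with x Fin.≟ src f | x Fin.≟ tgt f
      ... | yes q | yes r = contradiction (trans (sym q) r) (loopless G f)
      ... | no _  | no _  = links-degree x fs ps u
      ... | yes q | no _  = ℕ.≤-reflexive (cong suc (links-avoid x fs ps λ g∈ xg →
              lookup f≢ g∈ (colour-unique _ _ p (lookup ps g∈) (inj₁ q) xg)))
      ... | no _  | yes q = ℕ.≤-reflexive (cong suc (links-avoid x fs ps λ g∈ xg →
              lookup f≢ g∈ (colour-unique _ _ p (lookup ps g∈) (inj₂ q) xg)))

      links-solves : ∀ {c} fs ps → All (Solves c) (links fs ps) →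
                     ∀ {f} → f ∈ fs → R f (c (src f)) (c (tgt f))
      links-solves (f ∷ fs) (p ∷ ps) (s ∷ _)  (here refl) = s
      links-solves (f ∷ fs) (p ∷ ps) (_ ∷ ss) (there f∈)  = links-solves fs ps ss f∈

    -- Each class is a matching, so classes 1 and 2 together have maximum degree 2 and `solve`
    -- applies.
    solve-classes : (R S : Fin (m G) → ℕ → ℕ → Set) →
      (∀ f → col f ≡ 1F → Good (A (src f)) (A (tgt f)) (R f)) →
      (∀ f → col f ≡ 2F → Good (A (src f)) (A (tgt f)) (S f)) →
      ∃ λ c → (∀ v → c v ∈ A v)
            × (∀ f → col f ≡ 1F → R f (c (src f)) (c (tgt f)))
            × (∀ f → col f ≡ 2F → S f (c (src f)) (c (tgt f)))
    solve-classes R S gR gS =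
      c , c∈ ,
      (λ f p → links-solves R gR (class 1F) (mono 1F) (proj₁ split) (∈-filter⁺ _ (∈-allFin f) p)) ,
      (λ f p → links-solves S gS (class 2F) (mono 2F) (proj₂ split) (∈-filter⁺ _ (∈-allFin f) p))
      where
      class : Fin 3 → List (Fin (m G))
      class k = filter (λ f → col f Fin.≟ k) (allFin (m G))
      mono : ∀ k → All (λ f → col f ≡ k) (class k)
      mono k = all-filter (λ f → col f Fin.≟ k) (allFin (m G))
      distinct : ∀ k → Unique (class k)
      distinct k = Unique.filter⁺ (λ f → col f Fin.≟ k) (Unique.allFin⁺ (m G))
      ls₁ = links R gR (class 1F) (mono 1F)
      ls₂ = links S gS (class 2F) (mono 2F)
      sol = solve (ls₁ ++ ls₂) λ x → subst (_≤ 2) (sym (degree-++ x ls₁ ls₂))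
              (ℕ.+-mono-≤ (links-degree R gR x (class 1F) (mono 1F) (distinct 1F))
                          (links-degree S gS x (class 2F) (mono 2F) (distinct 2F)))
      c     = proj₁ sol
      c∈    = proj₁ (proj₂ sol)
      split = ++⁻ ls₁ (proj₂ (proj₂ sol))

  upTo-IsList : ∀ k → IsList k (upTo k)
  upTo-IsList k = Unique.upTo⁺ k , length-upTo k

  -- Lists are built only on some classes; the filler `x₀` makes them a function of all edges.
  classwise : {X : Set} {P : Fin (m G) → X → Set} {K : Fin (m G) → Set} → X →
              (∀ e → Dec (K e)) → (∀ e → K e → ∃ (P e)) → ∀ e → ∃ λ x → K e → P e x
  classwise x₀ K? f e with K? e
  ... | yes p = proj₁ (f e p) , λ _ → proj₂ (f e p)
  ... | no ¬p = x₀ , λ p → contradiction p ¬p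

  by-class : ∀ {P : Set} e → col e ≢ 0F → (col e ≡ 1F → P) → (col e ≡ 2F → P) → P
  by-class e ≢0 f g with col e
  ... | 0F = contradiction refl ≢0
  ... | 1F = f refl
  ... | 2F = g refl

  -- Rounds, each giving one colour to every class 1 edge

  record Round (k : ℕ) (L : Fin (m G) → List ℕ) : Set where
    field
      pick   : Fin (n G) → ℕ
      left   : Fin (m G) → List ℕ
      isLeft : ∀ e → col e ≢ 0F → IsList k (left e)
      left⊆  : ∀ e → col e ≢ 0F → left e ⊆ L e
      left∌  : ∀ e → col e ≢ 0F → ∀ {v} → v isEnd e → pick v ∉ left e
      -- `v` ranges over both ends, so `pick (src e)` is the colour of `e` seen from either end.
      agree  : ∀ e → col e ≡ 1F → ∀ {v} → v isEnd e → pick (src e) ≡ pick v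
      pick∈  : ∀ e → col e ≡ 1F → pick (src e) ∈ L e

  -- The ends of a class 1 edge get equal colours, and those of a class 2 edge share around its
  -- list, so in both cases the two picks cost one colour.
  round : ∀ k L → (∀ e → col e ≢ 0F → IsList (suc k) (L e)) → Round k L
  round k L isL = record
    { pick   = c
    ; left   = proj₁ ∘ rest
    ; isLeft = λ e p → proj₁ (proj₂ (rest e) p)
    ; left⊆  = λ e p → proj₁ (proj₂ (proj₂ (rest e) p))
    ; left∌  = λ { e p (inj₁ refl) c∈ → proj₁ (proj₂ (proj₂ (proj₂ (rest e) p)) c∈) (here refl)
                 ; e p (inj₂ refl) c∈ → proj₂ (proj₂ (proj₂ (proj₂ (rest e) p)) c∈) (here refl) }
    ; agree  = λ { e p (inj₁ refl) → refl ; e p (inj₂ refl) → same e p }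
    ; pick∈  = λ e p → subst (c (src e) ∈_) (A≡ (src e) e p (inj₁ refl)) (c∈A (src e))
    }
    where
    1≢0 : ∀ e → col e ≡ 1F → col e ≢ 0F
    1≢0 e p q with trans (sym p) q
    ... | ()
    2≢0 : ∀ e → col e ≡ 2F → col e ≢ 0F
    2≢0 e p q with trans (sym p) q
    ... | ()

    lists = spread 1F (λ _ → IsList (suc k)) L (λ _ → _ , upTo-IsList (suc k)) λ e _ p _ → isL e (1≢0 e p)
    A    = proj₁ ∘ lists
    isA  = λ v → proj₁ (proj₂ (lists v))
    A≡   = λ v → proj₂ (proj₂ (lists v))

    chosen = solve-classes A (IsList-inhabited ∘ isA) (λ _ → _≡_) (Share ∘ L)
      -- Both ends carry the list of `f`, so equality is a good relation between them.
      (λ f p → subst (λ B → Good (A (src f)) B _≡_)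
                 (trans (A≡ (src f) f p (inj₁ refl)) (sym (A≡ (tgt f) f p (inj₂ refl)))) Good-≡)
      (λ f p → Good-Share (isA (src f)) (isA (tgt f)) (isL f (2≢0 f p)))
    c     = proj₁ chosen
    c∈A   = proj₁ (proj₂ chosen)
    same  = proj₁ (proj₂ (proj₂ chosen))
    share = proj₂ (proj₂ (proj₂ chosen))

    rest = classwise [] (λ e → ¬? (col e Fin.≟ 0F)) λ e p →
      avoid-sharing {P = [ c (src e) ]} {Q = [ c (tgt e) ]} 0 0 refl refl (here refl) (here refl)
        (by-class e p (inj₁ ∘ same e) (share e))
        (subst (λ l → IsList l (L e)) (ℕ.+-comm 1 k) (isL e p))

  -- Assembling the sets of two colours

  module _ (L : Fin (m G) → List ℕ) (isL : ∀ e → IsList 7 (L e)) where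

    lists = spread 0F (λ _ → IsList 7) L (λ _ → _ , upTo-IsList 7) λ e _ _ _ → isL e
    A     = proj₁ ∘ lists
    isA   = λ v → proj₁ (proj₂ (lists v))
    A≡    = λ v → proj₂ (proj₂ (lists v))

    chosen = solve-classes A (IsList-inhabited ∘ isA) (Share ∘ L) (Share ∘ L)
      (λ f _ → Good-Share (isA (src f)) (isA (tgt f)) (isL f))
      (λ f _ → Good-Share (isA (src f)) (isA (tgt f)) (isL f))
    c   = proj₁ chosen
    c∈A = proj₁ (proj₂ chosen)

    pairs = classwise [] (λ e → col e Fin.≟ 0F) λ e p → pair-containing (isL e)
      (subst (c (src e) ∈_) (A≡ (src e) e p (inj₁ refl)) (c∈A (src e)))
      (subst (c (tgt e) ∈_) (A≡ (tgt e) e p (inj₂ refl)) (c∈A (tgt e)))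

    c∈pairs : ∀ e v → col e ≡ 0F → v isEnd e → c v ∈ proj₁ (pairs e)
    c∈pairs e _ p (inj₁ refl) = proj₁ (proj₂ (proj₂ (pairs e) p))
    c∈pairs e _ p (inj₂ refl) = proj₂ (proj₂ (proj₂ (pairs e) p))

    used = spread 0F (λ v P → length P ≡ 2 × c v ∈ P) (proj₁ ∘ pairs)
      -- A vertex missed by class 0 forbids only its own colour, repeated so that every vertex has a
      -- list of length 2.
      (λ v → c v ∷ c v ∷ [] , refl , here refl)
      (λ e v p ve → proj₂ (proj₁ (proj₁ (proj₂ (pairs e) p))) , c∈pairs e v p ve)

    fours = classwise [] (λ e → ¬? (col e Fin.≟ 0F)) λ e p →
      let _ , (lP , p∈P) , _ = used (src e)
          _ , (lQ , q∈Q) , _ = used (tgt e)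
          _ , _ , share₁ , share₂ = chosen
      -- Each end forbids one colour besides its `c`, and the two values of `c` cost one together:
      -- `7 = 4 + (1 + 1 + 1)`.
      in avoid-sharing {4} 1 1 lP lQ p∈P q∈Q (by-class e p (share₁ e) (share₂ e)) (isL e)

    -- As `e` is the only class 0 edge at `v`, the list removed there from the colours of `f` is the
    -- pair of `e`.
    fours-avoid : ∀ {v} e f → col e ≡ 0F → col f ≢ 0F → v isEnd e → v isEnd f →
                  ∀ {x} → x ∈ proj₁ (pairs e) → x ∉ proj₁ (fours f)
    fours-avoid {v} e f p q ve vf {x} x∈e x∈f =
      off vf (subst (x ∈_) (sym (proj₂ (proj₂ (used v)) e p ve)) x∈e)
      where
      off : v isEnd f → x ∉ proj₁ (used v)
      off (inj₁ refl) = proj₁ (proj₂ (proj₂ (proj₂ (fours f) q)) x∈f)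
      off (inj₂ refl) = proj₂ (proj₂ (proj₂ (proj₂ (fours f) q)) x∈f)

    open Round
    round₁ = round 3 (proj₁ ∘ fours) (λ e p → proj₁ (proj₂ (fours e) p))
    round₂ = round 2 (left round₁) (isLeft round₁)

    -- The class is a separate argument so that it can be matched on; the final choice takes it to
    -- be `col e`.
    choice : Fin 3 → Fin (m G) → List ℕ
    choice 0F e = proj₁ (pairs e)
    choice 1F e = pick round₁ (src e) ∷ pick round₂ (src e) ∷ []
    choice 2F e = left round₂ e

    choice⊆fours : ∀ k e → col e ≡ k → k ≢ 0F → choice k e ⊆ proj₁ (fours e)
    choice⊆fours 0F e p k≢0 = contradiction refl k≢0
    choice⊆fours 1F e p k≢0 (here refl) = pick∈ round₁ e p
    choice⊆fours 1F e p k≢0 (there (here refl)) =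
      left⊆ round₁ e (k≢0 ∘ trans (sym p)) (pick∈ round₂ e p)
    choice⊆fours 2F e p k≢0 =
      left⊆ round₁ e (k≢0 ∘ trans (sym p)) ∘ left⊆ round₂ e (k≢0 ∘ trans (sym p))

    choice⊆L : ∀ k e → col e ≡ k → k ≢ 0F → All (_∈ L e) (choice k e)
    choice⊆L k e p k≢0 = tabulate
      (proj₁ (proj₂ (proj₂ (fours e) (k≢0 ∘ trans (sym p)))) ∘ choice⊆fours k e p k≢0)

    choice-valid : ∀ k e → col e ≡ k → IsList 2 (choice k e) × All (_∈ L e) (choice k e)
    choice-valid 0F e p = proj₁ (proj₂ (pairs e) p)
    choice-valid 1F e p = (((fresh ∷ []) ∷ [] ∷ []) , refl) , choice⊆L 1F e p λ ()
      where
      -- The second round picks from lists that already avoid the first pick.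
      fresh : pick round₁ (src e) ≢ pick round₂ (src e)
      fresh eq = left∌ round₁ e (λ q → contradiction (trans (sym p) q) λ ()) (inj₁ refl)
                   (subst (_∈ left round₁ e) (sym eq) (pick∈ round₂ e p))
    choice-valid 2F e p = isLeft round₂ e (λ q → contradiction (trans (sym p) q) λ ()) , choice⊆L 2F e p λ ()

    -- By `agree` the colours of `e` are the picks at `v`, and the lists left to `f` avoid the picks
    -- at its ends.
    choice-disjoint₁₂ : ∀ {v} e f → col e ≡ 1F → col f ≡ 2F → v isEnd e → v isEnd f →
                        ∀ {x} → x ∈ choice 1F e → x ∉ choice 2F f
    choice-disjoint₁₂ e f p q ve vf = λ where
        (here refl) x∈f → left∌ round₁ f f≢0 vf
          (subst (_∈ left round₁ f) (agree round₁ e p ve) (left⊆ round₂ f f≢0 x∈f))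
        (there (here refl)) x∈f → left∌ round₂ f f≢0 vf
          (subst (_∈ left round₂ f) (agree round₂ e p ve) x∈f)
      where
      f≢0 : col f ≢ 0F
      f≢0 r = contradiction (trans (sym q) r) λ ()

    -- Against class 0, the other classes choose inside `fours`, which avoids the pairs.
    choice-disjoint : ∀ {v} k l e f → col e ≡ k → col f ≡ l → k ≢ l → v isEnd e → v isEnd f →
                      ∀ {x} → x ∈ choice k e → x ∉ choice l f
    choice-disjoint 1F 2F e f p q _ ve vf x∈e x∈f = choice-disjoint₁₂ e f p q ve vf x∈e x∈f
    choice-disjoint 2F 1F e f p q _ ve vf x∈e x∈f = choice-disjoint₁₂ f e q p vf ve x∈f x∈e
    choice-disjoint 0F l  e f p q k≢l ve vf x∈e x∈f =
      fours-avoid e f p (k≢l ∘ sym ∘ trans (sym q)) ve vf x∈e (choice⊆fours l f q (k≢l ∘ sym) x∈f)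
    choice-disjoint k  0F e f p q k≢l ve vf x∈e x∈f =
      fours-avoid f e q (k≢l ∘ trans (sym p)) vf ve x∈f (choice⊆fours k e p k≢l x∈e)
    choice-disjoint 1F 1F _ _ _ _ k≢l _ _ _ _ = contradiction refl k≢l
    choice-disjoint 2F 2F _ _ _ _ k≢l _ _ _ _ = contradiction refl k≢l

    choose : Σ (Fin (m G) → List ℕ) λ C →
        (∀ e → IsList 2 (C e) × All (_∈ L e) (C e))
      × (∀ e f → Incident G e f → ∀ x → x ∈ C e → x ∉ C f)
    choose = (λ e → choice (col e) e) , (λ e → choice-valid (col e) e refl) ,
      λ { e f inc@(_ , _ , ve , vf) _ → choice-disjoint (col e) (col f) e f refl refl (proper e f inc) ve vf }

theorem1 : (G : Graph) → ThreeEdgeColorable G → EdgeChoosable 7 2 G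
theorem1 G (col , proper) = Coloured.choose G col proper
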